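{- Let $\varphi=\frac12(1+\sqrt5)$. For an instance of IncMaxCont with density function $d$ and a starting value $c_1>0$, the algorithm $\mathrm{GreedyScaling}(c_1,\varphi+1)$ is $(\varphi+1)$-competitive if and only if $d(c_1)\ge\frac{1}{\varphi+1}$.
   Context: IncMaxCont. An instance is given by a density function $d:\mathbb{R}_{\ge 0}\to(0,1]$ and the value function $v(c):=c\,d(c)$. Standing assumptions: $d$ is non-increasing, $v$ is non-decreasing, $d$ and $v$ are continuous, $d(0)=1$, and $\lim_{c\to\infty}v(c)=\infty$. A solution is a sequence $X=(c_1,c_2,\dots)$ of positive real sizes. For a size $c>0$, with $n\in\mathbb{N}$ such that $\sum_{i=1}^{n-1}c_i<c\le\sum_{i=1}^{n}c_i$, define $$f(X(c)):=\max\Bigl\{\max_{i\in\{1,\dots,n-1\}}v(c_i),\ \Bigl(c-\sum_{i=1}^{n-1}c_i\Bigr)d(c_n)\Bigr\},$$ where the maximum over the empty set is $0$. For $\rho\ge 1$, $X$ is $\rho$-competitive if $\rho\cdot f(X(c))\ge v(c)$ for all $c>0$. For $\rho\ge 1$ let $p(c):=\max\{c'\ge 0: v(c')\le\rho v(c)\}$. GreedyScaling. For the algorithm it is assumed that $v$ is strictly increasing and $d$ is strictly decreasing. $\mathrm{GreedyScaling}(c_1,\rho)$ starts with the size $c_1>0$ and, for every $i\in\mathbb{N}$, chooses the size $c_{i+1}$ such that $$d(c_{i+1})=\frac{v(c_i)}{p(c_i)-\sum_{j=1}^{i}c_j},$$ producing the solution $(c_1,c_2,\dots)$. The algorithm is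 called $\rho$-competitive on the instance if the solution it produces is $\rho$-competitive.
   Formalization: Adds the assumption that d gets down to each positive density that the algorithm prescribes, so that the next size exists; this can fail if d does not tend to 0, e.g. d(c)=1/2+1/(2(1+c)), c₁=10, where there is no c₂ although d(c₁)≥1/(φ+1). -}

module Defs where

open import Algebra.Bundles using (CommutativeRing)
open import Algebra.Core using (Op₁; Op₂)
open import Algebra.Structures using (IsCommutativeRing)
import Algebra.Construct.NaturalChoice.Max as Max
open import Data.Nat.Base as ℕ using (ℕ; zero; suc)
open import Data.Product.Base using (_×_; ∃-syntax; Σ-syntax)
open import Level using (_⊔_) renaming (suc to lsuc)
open import Relation.Binary.Bundles using (TotalOrder)
open import Relation.Binary.Core using (Rel)
open import Relation.Binary.Structures using (IsTotalOrder)
import Relation.Binary.Construct.NonStrictToStrict as ToStrict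

-- The real numbers are axiomatised as a Dedekind-complete ordered field, which
-- classically determines them up to isomorphism.
record CompleteOrderedField c ℓ₁ ℓ₂ : Set (lsuc (c ⊔ ℓ₁ ⊔ ℓ₂)) where
  infix  9 _⁻¹
  infix  8 -_
  infixl 7 _*_
  infixl 6 _+_
  infix  4 _≈_ _≤_
  field
    Carrier           : Set c
    _≈_               : Rel Carrier ℓ₁
    _≤_               : Rel Carrier ℓ₂
    _+_ _*_           : Op₂ Carrier
    -_                : Op₁ Carrier
    0# 1#             : Carrier
    -- As usual for a total inverse, 0# ⁻¹ is an unspecified element.
    _⁻¹               : Op₁ Carrier
    isCommutativeRing : IsCommutativeRing _≈_ _+_ _*_ -_ 0# 1#
    isTotalOrder      : IsTotalOrder _≈_ _≤_

  commutativeRing : CommutativeRing c ℓ₁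
  commutativeRing = record { isCommutativeRing = isCommutativeRing }

  open CommutativeRing commutativeRing public using (_≉_; _-_)

  totalOrder : TotalOrder c ℓ₁ ℓ₂
  totalOrder = record { isTotalOrder = isTotalOrder }

  open ToStrict _≈_ _≤_ public using (_<_)
  open Max totalOrder public using () renaming (_⊔_ to max)

  IsUpperBound : (Carrier → Set (c ⊔ ℓ₁ ⊔ ℓ₂)) → Carrier → Set (c ⊔ ℓ₁ ⊔ ℓ₂)
  IsUpperBound P b = ∀ x → P x → x ≤ b

  field
    1≉0             : 1# ≉ 0#
    ⁻¹-inverseʳ     : ∀ x → x ≉ 0# → x * x ⁻¹ ≈ 1#
    +-monoˡ-≤       : ∀ z {x y} → x ≤ y → x + z ≤ y + z
    *-nonNegative   : ∀ {x y} → 0# ≤ x → 0# ≤ y → 0# ≤ x * y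
    supremum        : ∀ (P : Carrier → Set (c ⊔ ℓ₁ ⊔ ℓ₂)) →
                      (∃[ x ] P x) → (∃[ b ] IsUpperBound P b) →
                      ∃[ s ] IsUpperBound P s × (∀ b → IsUpperBound P b → s ≤ b)

  infixl 7 _/_
  _/_ : Op₂ Carrier
  x / y = x * y ⁻¹

  ∣_∣ : Op₁ Carrier
  ∣ x ∣ = max x (- x)

  2# 5# : Carrier
  2# = 1# + 1#
  5# = 2# + 2# + 1#

module IncMaxCont {c ℓ₁ ℓ₂} (R : CompleteOrderedField c ℓ₁ ℓ₂) where

  open CompleteOrderedField R

  -- A function on ℝ≥0 is represented by a function on all of ℝ, about whose
  -- values at negative arguments nothing is assumed.
  Continuous : Op₁ Carrier → Set (c ⊔ ℓ₁ ⊔ ℓ₂)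
  Continuous g = ∀ x → 0# ≤ x → ∀ ε → 0# < ε →
    ∃[ δ ] 0# < δ × (∀ y → 0# ≤ y → ∣ y - x ∣ < δ → ∣ g y - g x ∣ < ε)

  TendsToInfinity : Op₁ Carrier → Set (c ⊔ ℓ₂)
  TendsToInfinity g = ∀ M → ∃[ N ] (∀ x → 0# ≤ x → N ≤ x → M ≤ g x)

  record Instance : Set (c ⊔ ℓ₁ ⊔ ℓ₂) where
    field
      d : Op₁ Carrier

    v : Op₁ Carrier
    v x = x * d x

    field
      d-positive      : ∀ x → 0# ≤ x → 0# < d x
      d-≤1            : ∀ x → 0# ≤ x → d x ≤ 1#
      d-nonIncreasing : ∀ x y → 0# ≤ x → x ≤ y → d y ≤ d x
      v-nonDecreasing : ∀ x y → 0# ≤ x → x ≤ y → v x ≤ v y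
      d-continuous    : Continuous d
      v-continuous    : Continuous v
      d-0             : d 0# ≈ 1#
      v-unbounded     : TendsToInfinity v

  record IsStrict (I : Instance) : Set (c ⊔ ℓ₁ ⊔ ℓ₂) where
    open Instance I
    field
      d-decreasing : ∀ x y → 0# ≤ x → x < y → d y < d x
      v-increasing : ∀ x y → 0# ≤ x → x < y → v x < v y

  -- Sequences are indexed from 0, so the size cᵢ is X (i - 1).
  Sequence : Set c
  Sequence = ℕ → Carrier

  -- total X n = c₁ + … + cₙ
  total : Sequence → ℕ → Carrier
  total X zero    = 0#
  total X (suc n) = total X n + X n

  module _ (I : Instance) where

    open Instance I

    IsSolution : Sequence → Set (ℓ₁ ⊔ ℓ₂)
    IsSolution X = ∀ i → 0# < X i

    -- The maximum of v(c₁), …, v(cₙ), and 0 if n = 0.  Starting from 0 does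
    -- not affect the other cases because v is non-negative.
    best : Sequence → ℕ → Carrier
    best X zero    = 0#
    best X (suc n) = max (best X n) (v (X n))

    -- The value of X at size x, when exactly n sizes are already completed,
    -- i.e. when c₁ + … + cₙ < x ≤ c₁ + … + cₙ₊₁.
    value : Sequence → ℕ → Carrier → Carrier
    value X n x = max (best X n) ((x - total X n) * d (X n))

    IsCompetitive : Carrier → Sequence → Set (c ⊔ ℓ₁ ⊔ ℓ₂)
    IsCompetitive ρ X = ∀ x → 0# < x →
      ∃[ n ] total X n < x × x ≤ total X (suc n) × v x ≤ ρ * value X n x

    -- q = p(x) = max { x' ≥ 0 : v(x') ≤ ρ v(x) }
    IsThreshold : Carrier → Carrier → Carrier → Set (c ⊔ ℓ₂)
    IsThreshold ρ x q =
      0# ≤ q × v q ≤ ρ * v x × (∀ y → 0# ≤ y → v y ≤ ρ * v x → y ≤ q)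

    -- With p = p(cₙ) and n = suc i, the density prescribed for cₙ₊₁.
    prescribed : Sequence → ℕ → Carrier → Carrier
    prescribed X i p = v (X i) / (p - total X (suc i))

    -- X (suc i) is a valid choice after X 0, …, X i.
    Step : Carrier → Sequence → ℕ → Set (c ⊔ ℓ₁ ⊔ ℓ₂)
    Step ρ X i = 0# < X (suc i) ×
      (∃[ p ] IsThreshold ρ (X i) p × p - total X (suc i) ≉ 0# ×
              d (X (suc i)) ≈ prescribed X i p)

    -- The sizes X 0, …, X n, but not necessarily the later ones, are as
    -- chosen by the algorithm.
    IsPartialRun : Carrier → Carrier → ℕ → Sequence → Set (c ⊔ ℓ₁ ⊔ ℓ₂)
    IsPartialRun c₁ ρ n X = X 0 ≈ c₁ × (∀ i → i ℕ.< n → Step ρ X i)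

    IsGreedyScaling : Carrier → Carrier → Sequence → Set (c ⊔ ℓ₁ ⊔ ℓ₂)
    IsGreedyScaling c₁ ρ X = X 0 ≈ c₁ × (∀ i → Step ρ X i)

    GreedyScalingIsCompetitive : Carrier → Carrier → Set (c ⊔ ℓ₁ ⊔ ℓ₂)
    GreedyScalingIsCompetitive c₁ ρ =
      Σ[ X ∈ Sequence ] IsGreedyScaling c₁ ρ X × IsSolution X × IsCompetitive ρ X

    -- The algorithm presupposes that d falls to the densities it prescribes,
    -- which can fail if d does not tend to 0: for d(x) = 1/2 + 1/(2(1 + x)),
    -- ρ = φ + 1 and c₁ large, the density prescribed for c₂ is close to
    -- 1/(2φ) < 1/2 < d, so that there is no c₂.  The condition below is implied
    -- by d(x) → 0, and also by the mere existence of a run of the algorithm.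
    -- It asserts neither that p(cₙ) exceeds c₁ + … + cₙ, nor that the
    -- prescribed density is at most 1, nor that d attains it.
    DensityFallsFarEnough : Carrier → Carrier → Set (c ⊔ ℓ₁ ⊔ ℓ₂)
    DensityFallsFarEnough c₁ ρ = ∀ X n p →
      IsPartialRun c₁ ρ n X → IsThreshold ρ (X n) p → 0# < p - total X (suc n) →
      ∃[ x ] 0# ≤ x × d x ≤ prescribed X n p

{-# OPTIONS --safe #-}
module Submission where

-- Write S for c₁ + … + cₙ, x for cₙ, p for p(x) and ρ = φ + 1 = φ².  The run
-- keeps S ≤ φ x.  As p ≥ ρ x, this gives p - S ≥ x, so that the prescribed
-- density lies between 0 and 1 and is attained by continuity; the invariant
-- also forces the new size y to satisfy y ≥ p ≥ ρ x, whence S + y ≤ φ y again,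
-- and the sizes stay above c₁, so that their sums are unbounded.  On (S, S + y]
-- the value v(x) suffices up to p; at p the growing set has value v(x) as well,
-- and from there on its value grows at least as fast, relatively, as v.  Hence
-- only the first interval constrains the algorithm, and there competitiveness
-- means d(x) ≤ ρ d(c₁) for 0 < x ≤ c₁, that is 1 = d(0) ≤ ρ d(c₁).

open import Defs
open import Algebra.Bundles using (CommutativeRing)
open import Axiom.ExcludedMiddle using (ExcludedMiddle)
open import Data.Nat as ℕ using (ℕ; zero; suc)
import Data.Nat.Properties as ℕ
open import Data.Product.Base using (_×_; _,_; ∃-syntax; proj₁; proj₂)
open import Data.Sum.Base using (_⊎_; inj₁; inj₂)
open import Function.Base using (_∘_)
open import Function.Bundles using (_⇔_; mk⇔)
open import Level using (_⊔_; Lift; lift; lower)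
open import Relation.Binary.Bundles using (TotalOrder)
open import Relation.Binary.PropositionalEquality.Core as ≡ using (_≡_)
open import Relation.Nullary using (Dec; yes; no; ¬_; contradiction)
open import Relation.Nullary.Decidable using (map′; decidable-stable)
import Algebra.Construct.NaturalChoice.Max as Max
import Algebra.Properties.Ring as RingProperties
import Algebra.Solver.Ring.NaturalCoefficients.Default as NaturalCoefficients
import Relation.Binary.Properties.TotalOrder as TotalOrderProperties
import Relation.Binary.Reasoning.PartialOrder as PartialOrderReasoning

-- Order and arithmetic in a complete ordered field.

module OrderedField {c ℓ₁ ℓ₂} (em : ExcludedMiddle (c ⊔ ℓ₁ ⊔ ℓ₂))
                    (R : CompleteOrderedField c ℓ₁ ℓ₂) where

  open CompleteOrderedField R
  open IncMaxCont R using (Continuous)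
  open CommutativeRing commutativeRing public using
    ( refl; sym; trans; commutativeSemiring; ring
    ; +-cong; +-congˡ; +-congʳ; +-comm; +-identityˡ; +-identityʳ
    ; *-cong; *-congˡ; *-congʳ; *-assoc; *-comm; *-identityˡ; *-identityʳ
    ; distribˡ; distribʳ; zeroˡ; zeroʳ; -‿cong; -‿inverseˡ)
  open RingProperties ring public using
    ( //-rightDividesˡ; //-rightDividesʳ; x[y-z]≈xy-xz; -‿involutive
    ; -1*x≈-x; -‿+-comm; -0#≈0#)
  open TotalOrder totalOrder public using (poset; antisym)
    renaming (total to ≤-total; refl to ≤-refl; reflexive to ≤-reflexive; trans to ≤-trans)
  open TotalOrderProperties totalOrder public using (<⇒≱; ≰⇒>)
  open Max totalOrder public using (⊔-sel; x≤x⊔y; x≤y⊔x; ⊔-lub)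
  module ≤-Reasoning = PartialOrderReasoning poset
  open NaturalCoefficients commutativeSemiring public
    using (solve; _:=_; _:+_; _:*_; con)

  open ≤-Reasoning

  infix 4 _≤?_

  _≤?_ : ∀ x y → Dec (x ≤ y)
  x ≤? y = map′ lower lift (em {Lift (c ⊔ ℓ₁) (x ≤ y)})

  ≤-by-contradiction : ∀ {x y} → ¬ (y < x) → x ≤ y
  ≤-by-contradiction {x} {y} y≮x = decidable-stable (x ≤? y) (y≮x ∘ ≰⇒>)

  <-≤-trans : ∀ {x y z} → x < y → y ≤ z → x < z
  <-≤-trans {x} {y} {z} x<y y≤z = begin-strict x <⟨ x<y ⟩ y ≤⟨ y≤z ⟩ z ∎

  ≤-<-trans : ∀ {x y z} → x ≤ y → y < z → x < z
  ≤-<-trans {x} {y} {z} x≤y y<z = begin-strict x ≤⟨ x≤y ⟩ y <⟨ y<z ⟩ z ∎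

  +-monoʳ-≤ : ∀ z {x y} → x ≤ y → z + x ≤ z + y
  +-monoʳ-≤ z {x} {y} x≤y = begin
    z + x  ≈⟨ +-comm z x ⟩
    x + z  ≤⟨ +-monoˡ-≤ z x≤y ⟩
    y + z  ≈⟨ +-comm y z ⟩
    z + y  ∎

  +-cancelʳ-≤ : ∀ z {x y} → x + z ≤ y + z → x ≤ y
  +-cancelʳ-≤ z {x} {y} x+z≤y+z = begin
    x          ≈⟨ //-rightDividesʳ z x ⟨
    x + z - z  ≤⟨ +-monoˡ-≤ (- z) x+z≤y+z ⟩
    y + z - z  ≈⟨ //-rightDividesʳ z y ⟩
    y          ∎

  +-cancelˡ-≤ : ∀ z {x y} → z + x ≤ z + y → x ≤ y
  +-cancelˡ-≤ z {x} {y} z+x≤z+y = +-cancelʳ-≤ z (begin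
    x + z  ≈⟨ +-comm x z ⟩
    z + x  ≤⟨ z+x≤z+y ⟩
    z + y  ≈⟨ +-comm z y ⟩
    y + z  ∎)

  +-monoˡ-< : ∀ z {x y} → x < y → x + z < y + z
  +-monoˡ-< z x<y = ≰⇒> (<⇒≱ x<y ∘ +-cancelʳ-≤ z)

  +-monoʳ-< : ∀ z {x y} → x < y → z + x < z + y
  +-monoʳ-< z x<y = ≰⇒> (<⇒≱ x<y ∘ +-cancelˡ-≤ z)

  x≤x+y : ∀ x {y} → 0# ≤ y → x ≤ x + y
  x≤x+y x {y} 0≤y = begin
    x       ≈⟨ +-identityʳ x ⟨
    x + 0#  ≤⟨ +-monoʳ-≤ x 0≤y ⟩
    x + y   ∎

  x<x+y : ∀ x {y} → 0# < y → x < x + y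
  x<x+y x {y} 0<y = begin-strict
    x       ≈⟨ +-identityʳ x ⟨
    x + 0#  <⟨ +-monoʳ-< x 0<y ⟩
    x + y   ∎

  x-y≤z⇒x≤z+y : ∀ {x y z} → x - y ≤ z → x ≤ z + y
  x-y≤z⇒x≤z+y {x} {y} {z} x-y≤z = begin
    x          ≈⟨ //-rightDividesˡ y x ⟨
    x - y + y  ≤⟨ +-monoˡ-≤ y x-y≤z ⟩
    z + y      ∎

  x+y≤z⇒x≤z-y : ∀ {x y z} → x + y ≤ z → x ≤ z - y
  x+y≤z⇒x≤z-y {x} {y} {z} x+y≤z = begin
    x          ≈⟨ //-rightDividesʳ y x ⟨
    x + y - y  ≤⟨ +-monoˡ-≤ (- y) x+y≤z ⟩
    z - y      ∎

  x≤y⇒0≤y-x : ∀ {x y} → x ≤ y → 0# ≤ y - x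
  x≤y⇒0≤y-x {x} {y} x≤y = x+y≤z⇒x≤z-y (begin
    0# + x  ≈⟨ +-identityˡ x ⟩
    x       ≤⟨ x≤y ⟩
    y       ∎)

  x<y⇒0<y-x : ∀ {x y} → x < y → 0# < y - x
  x<y⇒0<y-x {x} {y} x<y = ≰⇒> λ y-x≤0 → <⇒≱ x<y (begin
    y       ≤⟨ x-y≤z⇒x≤z+y y-x≤0 ⟩
    0# + x  ≈⟨ +-identityˡ x ⟩
    x       ∎)

  -‿anti-≤ : ∀ {x y} → x ≤ y → - y ≤ - x
  -‿anti-≤ {x} {y} x≤y = begin
    - y      ≤⟨ x+y≤z⇒x≤z-y (begin
                  - y + x  ≤⟨ +-monoʳ-≤ (- y) x≤y ⟩
                  - y + y  ≈⟨ -‿inverseˡ y ⟩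
                  0#       ∎) ⟩
    0# - x   ≈⟨ +-identityˡ (- x) ⟩
    - x      ∎

  -‿cancel-≤ : ∀ {x y} → - x ≤ - y → y ≤ x
  -‿cancel-≤ {x} {y} -x≤-y = begin
    y      ≈⟨ -‿involutive y ⟨
    - - y  ≤⟨ -‿anti-≤ -x≤-y ⟩
    - - x  ≈⟨ -‿involutive x ⟩
    x      ∎

  *-monoʳ-≤ : ∀ {z x y} → 0# ≤ z → x ≤ y → z * x ≤ z * y
  *-monoʳ-≤ {z} {x} {y} 0≤z x≤y = begin
    z * x                     ≈⟨ +-identityˡ (z * x) ⟨
    0# + z * x                ≤⟨ +-monoˡ-≤ (z * x) (*-nonNegative 0≤z (x≤y⇒0≤y-x x≤y)) ⟩
    z * (y - x) + z * x       ≈⟨ +-congʳ (x[y-z]≈xy-xz z y x) ⟩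
    z * y - z * x + z * x     ≈⟨ //-rightDividesˡ (z * x) (z * y) ⟩
    z * y                     ∎

  *-monoˡ-≤ : ∀ {z x y} → 0# ≤ z → x ≤ y → x * z ≤ y * z
  *-monoˡ-≤ {z} {x} {y} 0≤z x≤y = begin
    x * z  ≈⟨ *-comm x z ⟩
    z * x  ≤⟨ *-monoʳ-≤ 0≤z x≤y ⟩
    z * y  ≈⟨ *-comm z y ⟩
    y * z  ∎

  0≤1 : 0# ≤ 1#
  0≤1 with ≤-total 0# 1#
  ... | inj₁ 0≤1 = 0≤1
  ... | inj₂ 1≤0 = begin
    0#           ≤⟨ *-nonNegative 0≤-1 0≤-1 ⟩
    - 1# * - 1#  ≈⟨ -1*x≈-x (- 1#) ⟩
    - - 1#       ≈⟨ -‿involutive 1# ⟩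
    1#           ∎
    where
    0≤-1 : 0# ≤ - 1#
    0≤-1 = begin
      0#       ≤⟨ x≤y⇒0≤y-x 1≤0 ⟩
      0# - 1#  ≈⟨ +-identityˡ (- 1#) ⟩
      - 1#     ∎

  0<1 : 0# < 1#
  0<1 = 0≤1 , 1≉0 ∘ sym

  x-0≈x : ∀ x → x - 0# ≈ x
  x-0≈x x = trans (+-congˡ -0#≈0#) (+-identityʳ x)

  0<x⇒x≉0 : ∀ {x} → 0# < x → x ≉ 0#
  0<x⇒x≉0 (_ , 0≉x) = 0≉x ∘ sym

  ⁻¹-inverseˡ : ∀ x → x ≉ 0# → x ⁻¹ * x ≈ 1#
  ⁻¹-inverseˡ x x≉0 = trans (*-comm (x ⁻¹) x) (⁻¹-inverseʳ x x≉0)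

  ⁻¹-nonNegative : ∀ {x} → 0# < x → 0# ≤ x ⁻¹
  ⁻¹-nonNegative {x} 0<x = ≤-by-contradiction λ x⁻¹<0 → <⇒≱ 0<1 (begin
    1#        ≈⟨ ⁻¹-inverseʳ x (0<x⇒x≉0 0<x) ⟨
    x * x ⁻¹  ≤⟨ *-monoʳ-≤ (proj₁ 0<x) (proj₁ x⁻¹<0) ⟩
    x * 0#    ≈⟨ zeroʳ x ⟩
    0#        ∎)

  *-cancelˡ-≤ : ∀ {z x y} → 0# < z → z * x ≤ z * y → x ≤ y
  *-cancelˡ-≤ {z} {x} {y} 0<z zx≤zy = begin
    x               ≈⟨ cancel x ⟨
    z ⁻¹ * (z * x)  ≤⟨ *-monoʳ-≤ (⁻¹-nonNegative 0<z) zx≤zy ⟩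
    z ⁻¹ * (z * y)  ≈⟨ cancel y ⟩
    y               ∎
    where
    cancel : ∀ w → z ⁻¹ * (z * w) ≈ w
    cancel w = begin-equality
      z ⁻¹ * (z * w)  ≈⟨ *-assoc (z ⁻¹) z w ⟨
      z ⁻¹ * z * w    ≈⟨ *-congʳ (⁻¹-inverseˡ z (0<x⇒x≉0 0<z)) ⟩
      1# * w          ≈⟨ *-identityˡ w ⟩
      w               ∎

  *-monoʳ-< : ∀ {z x y} → 0# < z → x < y → z * x < z * y
  *-monoʳ-< 0<z x<y = ≰⇒> (<⇒≱ x<y ∘ *-cancelˡ-≤ 0<z)

  *-positive : ∀ {x y} → 0# < x → 0# < y → 0# < x * y
  *-positive {x} {y} 0<x 0<y = begin-strict
    0#      ≈⟨ zeroʳ x ⟨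
    x * 0#  <⟨ *-monoʳ-< 0<x 0<y ⟩
    x * y   ∎

  y/z*z≈y : ∀ y {z} → z ≉ 0# → y / z * z ≈ y
  y/z*z≈y y {z} z≉0 = begin-equality
    y * z ⁻¹ * z    ≈⟨ *-assoc y (z ⁻¹) z ⟩
    y * (z ⁻¹ * z)  ≈⟨ *-congˡ (⁻¹-inverseˡ z z≉0) ⟩
    y * 1#          ≈⟨ *-identityʳ y ⟩
    y               ∎

  y≤x*z⇒y/z≤x : ∀ {x y z} → 0# < z → y ≤ x * z → y / z ≤ x
  y≤x*z⇒y/z≤x {x} {y} {z} 0<z y≤x*z = *-cancelˡ-≤ 0<z (begin
    z * (y / z)  ≈⟨ *-comm z (y / z) ⟩
    y / z * z    ≈⟨ y/z*z≈y y (0<x⇒x≉0 0<z) ⟩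
    y            ≤⟨ y≤x*z ⟩
    x * z        ≈⟨ *-comm x z ⟩
    z * x        ∎)

  0<2 : 0# < 2#
  0<2 = begin-strict 0# <⟨ 0<1 ⟩ 1# <⟨ x<x+y 1# 0<1 ⟩ 2# ∎

  half-positive : ∀ {x} → 0# < x → 0# < x / 2#
  half-positive {x} 0<x = ≰⇒> λ x/2≤0 → <⇒≱ 0<x (begin
    x            ≈⟨ y/z*z≈y x (0<x⇒x≉0 0<2) ⟨
    x / 2# * 2#  ≤⟨ *-monoˡ-≤ (proj₁ 0<2) x/2≤0 ⟩
    0# * 2#      ≈⟨ zeroˡ 2# ⟩
    0#           ∎)


  half-< : ∀ {x} → 0# < x → x / 2# < x
  half-< {x} 0<x = begin-strict
    x / 2#                      <⟨ x<x+y (x / 2#) (half-positive 0<x) ⟩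
    x / 2# + x / 2#             ≈⟨ +-cong (*-identityʳ (x / 2#)) (*-identityʳ (x / 2#)) ⟨
    x / 2# * 1# + x / 2# * 1#   ≈⟨ distribˡ (x / 2#) 1# 1# ⟨
    x / 2# * 2#                 ≈⟨ y/z*z≈y x (0<x⇒x≉0 0<2) ⟩
    x                           ∎

  -- Absolute values, continuity and intermediate values.

  max-lub-< : ∀ {x y z} → x < z → y < z → max x y < z
  max-lub-< {x} {y} {z} x<z y<z with ⊔-sel x y
  ... | inj₁ x∨y≈x = begin-strict max x y ≈⟨ x∨y≈x ⟩ x <⟨ x<z ⟩ z ∎
  ... | inj₂ x∨y≈y = begin-strict max x y ≈⟨ x∨y≈y ⟩ y <⟨ y<z ⟩ z ∎

  -‿x-y≈y-x : ∀ x y → - (x - y) ≈ y - x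
  -‿x-y≈y-x x y = begin-equality
    - (x - y)    ≈⟨ -‿+-comm x (- y) ⟨
    - x - - y    ≈⟨ +-congˡ (-‿involutive y) ⟩
    - x + y      ≈⟨ +-comm (- x) y ⟩
    y - x        ∎

  x<y+z⇒x-y<z : ∀ {x y z} → x < y + z → x - y < z
  x<y+z⇒x-y<z {x} {y} {z} x<y+z = ≰⇒> λ z≤x-y → <⇒≱ x<y+z (begin
    y + z        ≤⟨ +-monoʳ-≤ y z≤x-y ⟩
    y + (x - y)  ≈⟨ +-comm y (x - y) ⟩
    x - y + y    ≈⟨ //-rightDividesˡ y x ⟩
    x            ∎)

  ∣x-y∣<z : ∀ {x y z} → x < y + z → y < x + z → ∣ x - y ∣ < z
  ∣x-y∣<z {x} {y} {z} x<y+z y<x+z = max-lub-< (x<y+z⇒x-y<z x<y+z) (begin-strict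
    - (x - y)  ≈⟨ -‿x-y≈y-x x y ⟩
    y - x      <⟨ x<y+z⇒x-y<z y<x+z ⟩
    z          ∎)

  -- The `δ`-neighbourhood of `x` among the non-negative reals, with the absolute value split into
  -- two inequalities free of subtraction.
  Near : Carrier → Carrier → Carrier → Set (ℓ₁ ⊔ ℓ₂)
  Near δ x y = 0# ≤ y × y < x + δ × x < y + δ

  -- Continuity is applied with tolerance `g x - K`: a nearby value at or below `K` would differ
  -- from `g x` by at least that much.
  >-near : ∀ {g x K} → Continuous g → 0# ≤ x → K < g x →
           ∃[ δ ] 0# < δ × (∀ y → Near δ x y → K < g y)
  >-near {g} {x} {K} g-cont 0≤x K<gx =
    let δ , 0<δ , close = g-cont x 0≤x (g x - K) (x<y⇒0<y-x K<gx) in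
    δ , 0<δ , λ y (0≤y , y<x+δ , x<y+δ) → ≰⇒> λ gy≤K →
      <⇒≱ (close y 0≤y (∣x-y∣<z y<x+δ x<y+δ)) (begin
        g x - K            ≤⟨ +-monoʳ-≤ (g x) (-‿anti-≤ gy≤K) ⟩
        g x - g y          ≈⟨ -‿x-y≈y-x (g y) (g x) ⟨
        - (g y - g x)      ≤⟨ x≤y⊔x (g y - g x) (- (g y - g x)) ⟩
        ∣ g y - g x ∣      ∎)

  <-near : ∀ {g x K} → Continuous g → 0# ≤ x → g x < K →
           ∃[ δ ] 0# < δ × (∀ y → Near δ x y → g y < K)
  <-near {g} {x} {K} g-cont 0≤x gx<K =
    let δ , 0<δ , close = g-cont x 0≤x (K - g x) (x<y⇒0<y-x gx<K) in
    δ , 0<δ , λ y (0≤y , y<x+δ , x<y+δ) → ≰⇒> λ K≤gy →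
      <⇒≱ (close y 0≤y (∣x-y∣<z y<x+δ x<y+δ)) (begin
        K - g x            ≤⟨ +-monoˡ-≤ (- g x) K≤gy ⟩
        g y - g x          ≤⟨ x≤x⊔y (g y - g x) (- (g y - g x)) ⟩
        ∣ g y - g x ∣      ∎)

  -- `last-solution` treats functions that start at or below the target; negation makes it
  -- applicable to the decreasing `d`.
  -‿continuous : ∀ {g} → Continuous g → Continuous (λ x → - g x)
  -‿continuous {g} g-cont x 0≤x ε 0<ε =
    let δ , 0<δ , close = g-cont x 0≤x ε 0<ε in
    δ , 0<δ , λ y 0≤y y∼x → max-lub-<
      (begin-strict
        - g y - - g x      ≈⟨ -‿+-comm (g y) (- g x) ⟩
        - (g y - g x)      ≤⟨ x≤y⊔x (g y - g x) (- (g y - g x)) ⟩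
        ∣ g y - g x ∣      <⟨ close y 0≤y y∼x ⟩
        ε                  ∎)
      (begin-strict
        - (- g y - - g x)  ≈⟨ -‿cong (-‿+-comm (g y) (- g x)) ⟩
        - - (g y - g x)    ≈⟨ -‿involutive (g y - g x) ⟩
        g y - g x          ≤⟨ x≤x⊔y (g y - g x) (- (g y - g x)) ⟩
        ∣ g y - g x ∣      <⟨ close y 0≤y y∼x ⟩
        ε                  ∎)

  -- The witness is the supremum of the sublevel set of `K`. If `g s` exceeded `K`, a whole
  -- neighbourhood of `s` would miss the set and `s - δ` would be a smaller upper bound. If `g s`
  -- were below `K`, the set would contain `s + δ / 2#`.
  last-solution : ∀ {g K} → Continuous g → g 0# ≤ K →
    ∀ b → (∀ y → 0# ≤ y → g y ≤ K → y ≤ b) →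
    ∃[ s ] 0# ≤ s × g s ≈ K × (∀ y → 0# ≤ y → g y ≤ K → y ≤ s)
  last-solution {g} {K} g-cont g0≤K b bounded
    with supremum (λ y → Lift (c ⊔ ℓ₁) (0# ≤ y × g y ≤ K))
           (0# , lift (≤-refl , g0≤K))
           (b , λ y (lift (0≤y , gy≤K)) → bounded y 0≤y gy≤K)
  ... | s , upper , least = s , 0≤s , antisym gs≤K K≤gs , below
    where
    below : ∀ y → 0# ≤ y → g y ≤ K → y ≤ s
    below y 0≤y gy≤K = upper y (lift (0≤y , gy≤K))

    0≤s : 0# ≤ s
    0≤s = below 0# ≤-refl g0≤K

    gs≤K : g s ≤ K
    gs≤K = ≤-by-contradiction λ K<gs →
      let δ , 0<δ , near = >-near g-cont 0≤s K<gs in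
      <⇒≱ (x<x+y s 0<δ) (s+δ≤s δ (least (s - δ) λ y (lift (0≤y , gy≤K)) →
        x+y≤z⇒x≤z-y (≤-by-contradiction λ s<y+δ →
          <⇒≱ (near y (0≤y , ≤-<-trans (below y 0≤y gy≤K) (x<x+y s 0<δ) , s<y+δ)) gy≤K)))
      where
      s+δ≤s : ∀ δ → s ≤ s - δ → s + δ ≤ s
      s+δ≤s δ s≤s-δ = begin
        s + δ      ≤⟨ +-monoˡ-≤ δ s≤s-δ ⟩
        s - δ + δ  ≈⟨ //-rightDividesˡ δ s ⟩
        s          ∎

    K≤gs : K ≤ g s
    K≤gs = ≤-by-contradiction λ gs<K →
      let δ , 0<δ , near = <-near g-cont 0≤s gs<K
          s<t = x<x+y s (half-positive 0<δ)
          t = s + δ / 2#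
          0≤t = ≤-trans 0≤s (proj₁ s<t) in
      <⇒≱ s<t (below t 0≤t (proj₁ (near t
        (0≤t , +-monoʳ-< s (half-< 0<δ) , <-≤-trans s<t (x≤x+y t (proj₁ 0<δ))))))

module _ {c ℓ₁ ℓ₂} (em : ExcludedMiddle (c ⊔ ℓ₁ ⊔ ℓ₂)) (R : CompleteOrderedField c ℓ₁ ℓ₂) where

  open CompleteOrderedField R
  open IncMaxCont R
  open OrderedField em R
  open ≤-Reasoning hiding (IsStrict)

  -- The algorithm for a non-negative root `φ` of `φ * φ ≈ φ + 1#`.

  module GreedyScaling (φ : Carrier) (0≤φ : 0# ≤ φ) (φ²≈φ+1 : φ * φ ≈ φ + 1#)
                       (I : Instance) (strict : IsStrict I) where

    open Instance I
    open IsStrict strict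

    ρ : Carrier
    ρ = φ + 1#

    1≤φ : 1# ≤ φ
    1≤φ = ≤-by-contradiction λ φ<1 → <⇒≱ 0<1 (+-cancelˡ-≤ φ (begin
      φ + 1#  ≈⟨ φ²≈φ+1 ⟨
      φ * φ   ≤⟨ *-monoʳ-≤ 0≤φ (proj₁ φ<1) ⟩
      φ * 1#  ≈⟨ *-identityʳ φ ⟩
      φ       ≈⟨ +-identityʳ φ ⟨
      φ + 0#  ∎))

    0<φ : 0# < φ
    0<φ = <-≤-trans 0<1 1≤φ

    0<ρ : 0# < ρ
    0<ρ = <-≤-trans 0<φ (x≤x+y φ 0≤1)

    0≤ρ : 0# ≤ ρ
    0≤ρ = proj₁ 0<ρ

    ρ*x≈φ*x+x : ∀ x → ρ * x ≈ φ * x + x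
    ρ*x≈φ*x+x x = trans (distribʳ x φ 1#) (+-congˡ (*-identityˡ x))

    φ*[φ*x]≈ρ*x : ∀ x → φ * (φ * x) ≈ ρ * x
    φ*[φ*x]≈ρ*x x = trans (sym (*-assoc φ φ x)) (*-congʳ φ²≈φ+1)

    x≤φ*x : ∀ {x} → 0# ≤ x → x ≤ φ * x
    x≤φ*x {x} 0≤x = begin
      x       ≈⟨ *-identityˡ x ⟨
      1# * x  ≤⟨ *-monoˡ-≤ 0≤x 1≤φ ⟩
      φ * x   ∎

    x≤ρ*x : ∀ {x} → 0# ≤ x → x ≤ ρ * x
    x≤ρ*x {x} 0≤x = begin
      x          ≤⟨ x≤φ*x 0≤x ⟩
      φ * x      ≤⟨ x≤x+y (φ * x) 0≤x ⟩
      φ * x + x  ≈⟨ ρ*x≈φ*x+x x ⟨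
      ρ * x      ∎

    -- Densities, values and thresholds.

    -- `d` is a bare function on a setoid; monotonicity, used in both directions, makes it respect
    -- `_≈_`.
    d-cong : ∀ {x y} → 0# ≤ x → x ≈ y → d x ≈ d y
    d-cong {x} {y} 0≤x x≈y = antisym
      (d-nonIncreasing y x (≤-trans 0≤x (≤-reflexive x≈y)) (≤-reflexive (sym x≈y)))
      (d-nonIncreasing x y 0≤x (≤-reflexive x≈y))

    v-nonNegative : ∀ {x} → 0# ≤ x → 0# ≤ v x
    v-nonNegative {x} 0≤x = *-nonNegative 0≤x (proj₁ (d-positive x 0≤x))

    -- An intermediate value between `d 0#`, which is 1, and `d y`. Strict decrease puts `d` below
    -- `K` beyond `y`, so `y` bounds the set where `d` is at least `K`.
    d-attains : ∀ {K y} → K ≤ 1# → 0# ≤ y → d y ≤ K → ∃[ x ] 0# ≤ x × d x ≈ K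
    d-attains {K} {y} K≤1 0≤y dy≤K =
      let x , 0≤x , -dx≈-K , _ = last-solution (-‿continuous d-continuous)
            (-‿anti-≤ (≤-trans K≤1 (≤-reflexive (sym d-0)))) y
            (λ z 0≤z -dz≤-K → ≤-by-contradiction λ y<z →
              <⇒≱ (<-≤-trans (d-decreasing y z 0≤y y<z) dy≤K) (-‿cancel-≤ -dz≤-K))
      in x , 0≤x , antisym (-‿cancel-≤ (≤-reflexive (sym -dx≈-K)))
                           (-‿cancel-≤ (≤-reflexive -dx≈-K))

    v-last : ∀ {x} → 0# ≤ x →
      ∃[ p ] 0# ≤ p × v p ≈ ρ * v x × (∀ y → 0# ≤ y → v y ≤ ρ * v x → y ≤ p)
    v-last {x} 0≤x =
      let K = ρ * v x
          -- The added 1 makes `v` exceed `K` strictly from `N` on, so no solution lies beyond `N`.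
          N , large = v-unbounded (K + 1#) in
      last-solution v-continuous
        (begin
          0# * d 0#  ≈⟨ zeroˡ (d 0#) ⟩
          0#         ≤⟨ *-nonNegative 0≤ρ (v-nonNegative 0≤x) ⟩
          K          ∎)
        N λ y 0≤y vy≤K → ≤-by-contradiction λ N<y →
          <⇒≱ (x<x+y K 0<1) (≤-trans (large y 0≤y (proj₁ N<y)) vy≤K)

    threshold-exists : ∀ {x} → 0# ≤ x → ∃[ p ] IsThreshold I ρ x p
    threshold-exists 0≤x =
      let p , 0≤p , vp≈K , last = v-last 0≤x in
      p , 0≤p , ≤-reflexive vp≈K , last

    -- `IsThreshold` states only the opposite inequality. An exact solution `q` of `v q ≈ ρ * v x`
    -- exists by continuity, and maximality of `p` gives `q ≤ p`.
    threshold-attained : ∀ {x p} → 0# ≤ x → IsThreshold I ρ x p → ρ * v x ≤ v p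
    threshold-attained {x} {p} 0≤x (_ , _ , last) =
      let q , 0≤q , vq≈K , _ = v-last 0≤x in
      begin
        ρ * v x  ≈⟨ vq≈K ⟨
        v q      ≤⟨ v-nonDecreasing q p 0≤q (last q 0≤q (≤-reflexive vq≈K)) ⟩
        v p      ∎

    -- Scaling a size by `ρ` multiplies its value by at most `ρ`, since the density does not rise.
    ρ*x≤threshold : ∀ {x p} → 0# ≤ x → IsThreshold I ρ x p → ρ * x ≤ p
    ρ*x≤threshold {x} 0≤x (_ , _ , last) =
      last (ρ * x) 0≤ρ*x (begin
        ρ * x * d (ρ * x)  ≤⟨ *-monoʳ-≤ 0≤ρ*x (d-nonIncreasing x (ρ * x) 0≤x (x≤ρ*x 0≤x)) ⟩
        ρ * x * d x        ≈⟨ *-assoc ρ x (d x) ⟩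
        ρ * v x            ∎)
      where
      0≤ρ*x : 0# ≤ ρ * x
      0≤ρ*x = *-nonNegative 0≤ρ 0≤x

    -- A single step of the algorithm.

    -- The content of `Step` in terms of the last size `x` and the sum `S` alone, so that it can be
    -- stated before the sequence exists.
    NextSize : Carrier → Carrier → Carrier → Set (c ⊔ ℓ₁ ⊔ ℓ₂)
    NextSize x S y = 0# < y ×
      (∃[ p ] IsThreshold I ρ x p × p - S ≉ 0# × d y ≈ v x / (p - S))

    module AfterSize {x S p} (0<x : 0# < x) (0≤S : 0# ≤ S) (S≤φx : S ≤ φ * x)
                     (thr : IsThreshold I ρ x p) where

      0≤x : 0# ≤ x
      0≤x = proj₁ 0<x

      x≤p : x ≤ p
      x≤p = ≤-trans (x≤ρ*x 0≤x) (ρ*x≤threshold 0≤x thr)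

      0<p : 0# < p
      0<p = <-≤-trans 0<x x≤p

      0≤p : 0# ≤ p
      0≤p = proj₁ 0<p

      0≤dp : 0# ≤ d p
      0≤dp = proj₁ (d-positive p 0≤p)

      x≤gap : x ≤ p - S
      x≤gap = x+y≤z⇒x≤z-y (begin
        x + S      ≤⟨ +-monoʳ-≤ x S≤φx ⟩
        x + φ * x  ≈⟨ +-comm x (φ * x) ⟩
        φ * x + x  ≈⟨ ρ*x≈φ*x+x x ⟨
        ρ * x      ≤⟨ ρ*x≤threshold 0≤x thr ⟩
        p          ∎)

      0<gap : 0# < p - S
      0<gap = <-≤-trans 0<x x≤gap

      -- Holds because `v x ≤ x ≤ p - S`. It places the prescribed density within reach of `d`,
      -- which starts at 1.
      prescribed≤1 : v x / (p - S) ≤ 1#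
      prescribed≤1 = y≤x*z⇒y/z≤x 0<gap (begin
        x * d x         ≤⟨ *-monoʳ-≤ 0≤x (d-≤1 x 0≤x) ⟩
        x * 1#          ≤⟨ *-monoˡ-≤ 0≤1 x≤gap ⟩
        (p - S) * 1#    ≈⟨ *-comm (p - S) 1# ⟩
        1# * (p - S)    ∎)

      -- If y < p, then d p < d y, hence ρ v(x) = p d(p) < S d(p) + v(x), that is
      -- φ v(x) < S d(p); but S ≤ φ x and d p ≤ d x.
      threshold≤next : ∀ {y} → 0# ≤ y → d y ≈ v x / (p - S) → p ≤ y
      threshold≤next {y} 0≤y dy≈ = ≤-by-contradiction λ y<p → <⇒≱
        (begin-strict
          φ * v x + v x              ≈⟨ ρ*x≈φ*x+x (v x) ⟨
          ρ * v x                    ≤⟨ threshold-attained 0≤x thr ⟩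
          p * d p                    ≈⟨ *-congʳ (//-rightDividesˡ S p) ⟨
          (p - S + S) * d p          ≈⟨ distribʳ (d p) (p - S) S ⟩
          (p - S) * d p + S * d p    <⟨ +-monoˡ-< (S * d p)
                                          (*-monoʳ-< 0<gap (d-decreasing y p 0≤y y<p)) ⟩
          (p - S) * d y + S * d p    ≈⟨ +-comm ((p - S) * d y) (S * d p) ⟩
          S * d p + (p - S) * d y    ∎)
        (begin
          S * d p + (p - S) * d y    ≈⟨ +-congˡ gap*dy≈vx ⟩
          S * d p + v x              ≤⟨ +-monoˡ-≤ (v x) (*-monoˡ-≤ 0≤dp S≤φx) ⟩
          φ * x * d p + v x          ≤⟨ +-monoˡ-≤ (v x) (*-monoʳ-≤ (*-nonNegative 0≤φ 0≤x)
                                          (d-nonIncreasing x p 0≤x x≤p)) ⟩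
          φ * x * d x + v x          ≈⟨ +-congʳ (*-assoc φ x (d x)) ⟩
          φ * v x + v x              ∎)
        where
        gap*dy≈vx : (p - S) * d y ≈ v x
        gap*dy≈vx = begin-equality
          (p - S) * d y                  ≈⟨ *-comm (p - S) (d y) ⟩
          d y * (p - S)                  ≈⟨ *-congʳ dy≈ ⟩
          v x / (p - S) * (p - S)        ≈⟨ y/z*z≈y (v x) (0<x⇒x≉0 0<gap) ⟩
          v x                            ∎

      -- After multiplication by `φ` the old invariant turns `φ * S` into at most `ρ * x`, which is
      -- at most `p` and hence at most `y`; then `y + φ * y` is `φ * (φ * y)`.
      next-total-≤ : ∀ {y} → p ≤ y → S + y ≤ φ * y
      next-total-≤ {y} p≤y = *-cancelˡ-≤ 0<φ (begin
        φ * (S + y)            ≈⟨ distribˡ φ S y ⟩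
        φ * S + φ * y          ≤⟨ +-monoˡ-≤ (φ * y) (*-monoʳ-≤ 0≤φ S≤φx) ⟩
        φ * (φ * x) + φ * y    ≈⟨ +-congʳ (φ*[φ*x]≈ρ*x x) ⟩
        ρ * x + φ * y          ≤⟨ +-monoˡ-≤ (φ * y) (ρ*x≤threshold 0≤x thr) ⟩
        p + φ * y              ≤⟨ +-monoˡ-≤ (φ * y) p≤y ⟩
        y + φ * y              ≈⟨ +-comm y (φ * y) ⟩
        φ * y + y              ≈⟨ ρ*x≈φ*x+x y ⟨
        ρ * y                  ≈⟨ φ*[φ*x]≈ρ*x y ⟨
        φ * (φ * y)            ∎)

      -- Because z / (z - S) ≤ p / (p - S) for p ≤ z, and p d(z) ≤ v(p) ≤ ρ v(x).
      competitive-beyond : ∀ {y z} → d y ≈ v x / (p - S) → p ≤ z →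
        v z ≤ ρ * ((z - S) * d y)
      competitive-beyond {y} {z} dy≈ p≤z = *-cancelˡ-≤ (*-positive 0<gap 0<p) (begin
        (p - S) * p * (z * d z)            ≤⟨ *-monoʳ-≤ 0≤gap*p (*-monoʳ-≤ 0≤z
                                                (d-nonIncreasing p z 0≤p p≤z)) ⟩
        (p - S) * p * (z * d p)            ≈⟨ solve 4 (λ t p z e →
                                                t :* p :* (z :* e) := z :* t :* (p :* e))
                                                refl (p - S) p z (d p) ⟩
        z * (p - S) * v p                  ≤⟨ *-monoʳ-≤ (*-nonNegative 0≤z 0≤gap) vp≤ ⟩
        z * (p - S) * (ρ * v x)            ≤⟨ *-monoˡ-≤ (*-nonNegative 0≤ρ (v-nonNegative 0≤x))
                                                z*gap≤ ⟩
        p * (z - S) * (ρ * v x)            ≈⟨ *-congˡ (*-congˡ (y/z*z≈y (v x) (0<x⇒x≉0 0<gap))) ⟨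
        p * (z - S) *
          (ρ * (v x / (p - S) * (p - S)))  ≈⟨ *-congˡ (*-congˡ (*-congʳ dy≈)) ⟨
        p * (z - S) * (ρ * (d y * (p - S)))
                                           ≈⟨ solve 5 (λ p s r e t →
                                                p :* s :* (r :* (e :* t)) :=
                                                t :* p :* (r :* (s :* e)))
                                                refl p (z - S) ρ (d y) (p - S) ⟩
        (p - S) * p * (ρ * ((z - S) * d y)) ∎)
        where
        0≤z : 0# ≤ z
        0≤z = ≤-trans 0≤p p≤z

        0≤gap : 0# ≤ p - S
        0≤gap = proj₁ 0<gap

        0≤gap*p : 0# ≤ (p - S) * p
        0≤gap*p = *-nonNegative 0≤gap 0≤p

        vp≤ : v p ≤ ρ * v x
        vp≤ = proj₁ (proj₂ thr)

        z*gap≤ : z * (p - S) ≤ p * (z - S)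
        z*gap≤ = begin
          z * (p - S)      ≈⟨ x[y-z]≈xy-xz z p S ⟩
          z * p - z * S    ≤⟨ +-monoʳ-≤ (z * p) (-‿anti-≤ (*-monoˡ-≤ 0≤S p≤z)) ⟩
          z * p - p * S    ≈⟨ +-congʳ (*-comm z p) ⟩
          p * z - p * S    ≈⟨ x[y-z]≈xy-xz p z S ⟨
          p * (z - S)      ∎

    -- The invariant along a run.

    record Invariant (X : Sequence) (n : ℕ) : Set (ℓ₁ ⊔ ℓ₂) where
      field
        positive : 0# < X n
        first≤   : X 0 ≤ X n
        total≥0  : 0# ≤ total X n
        total≤φ  : total X (suc n) ≤ φ * X n

      next-total≥0 : 0# ≤ total X (suc n)
      next-total≥0 = ≤-trans total≥0 (x≤x+y (total X n) (proj₁ positive))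

    -- Formulated for partial runs because the existence of the next size itself relies on the
    -- invariant. The base case is `1# ≤ φ`; the induction step rests on the new size being at least
    -- `p`.
    invariant : ∀ {c₁ X} → 0# < c₁ → ∀ n → IsPartialRun I c₁ ρ n X → Invariant X n
    invariant {c₁} {X} 0<c₁ zero (X0≈c₁ , _) = record
      { positive = 0<X0
      ; first≤   = ≤-refl
      ; total≥0  = ≤-refl
      ; total≤φ  = ≤-trans (≤-reflexive (+-identityˡ (X 0))) (x≤φ*x (proj₁ 0<X0))
      }
      where
      0<X0 : 0# < X 0
      0<X0 = <-≤-trans 0<c₁ (≤-reflexive (sym X0≈c₁))
    invariant {c₁} {X} 0<c₁ (suc n) (X0≈c₁ , steps) =
      let open Invariant (invariant {c₁} {X} 0<c₁ n (X0≈c₁ , λ i → steps i ∘ ℕ.m<n⇒m<1+n))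
          0<x , p , thr , _ , dx≈ = steps n ℕ.≤-refl
          module A = AfterSize positive next-total≥0 total≤φ thr
          p≤x = A.threshold≤next (proj₁ 0<x) dx≈
      in record
        { positive = 0<x
        ; first≤   = ≤-trans first≤ (≤-trans A.x≤p p≤x)
        ; total≥0  = next-total≥0
        ; total≤φ  = A.next-total-≤ p≤x
        }

    -- The invariant makes `p - S` positive, as `falls` demands. The prescribed density then lies
    -- between a value of `d` and 1, and the size attaining it is positive because it is at least
    -- `p`.
    next-exists : ∀ {c₁ X} → 0# < c₁ → DensityFallsFarEnough I c₁ ρ →
      ∀ n → IsPartialRun I c₁ ρ n X → ∃[ x ] NextSize (X n) (total X (suc n)) x
    next-exists {c₁} {X} 0<c₁ falls n run =
      let open Invariant (invariant 0<c₁ n run)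
          p , thr = threshold-exists (proj₁ positive)
          module A = AfterSize positive next-total≥0 total≤φ thr
          y , 0≤y , dy≤ = falls X n p run thr A.0<gap
          x , 0≤x , dx≈ = d-attains A.prescribed≤1 0≤y dy≤
      in x , <-≤-trans A.0<p (A.threshold≤next 0≤x dx≈) , p , thr , 0<x⇒x≉0 A.0<gap , dx≈

    -- Construction of a run.

    -- Classical choice of a witness, with `0#` as default when there is none. Being total, it
    -- allows the sequence to be defined first and shown to be a run afterwards.
    choose : (Carrier → Set (c ⊔ ℓ₁ ⊔ ℓ₂)) → Carrier
    choose P with em {∃[ x ] P x}
    ... | yes (x , _) = x
    ... | no _        = 0#

    choose-satisfies : ∀ (P : Carrier → Set (c ⊔ ℓ₁ ⊔ ℓ₂)) → (∃[ x ] P x) → P (choose P)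
    choose-satisfies P ∃P with em {∃[ x ] P x}
    ... | yes (_ , Px) = Px
    ... | no ∄P        = contradiction ∃P ∄P

    -- The pair (Xₙ, X₀ + … + Xₙ); carrying the sum makes the recursion structural.
    greedyState : Carrier → ℕ → Carrier × Carrier
    greedyState c₁ zero    = c₁ , 0# + c₁
    greedyState c₁ (suc n) =
      let x , S = greedyState c₁ n
          y     = choose (NextSize x S)
      in y , S + y

    greedy : Carrier → Sequence
    greedy c₁ n = proj₁ (greedyState c₁ n)

    total-greedy : ∀ c₁ n → total (greedy c₁) (suc n) ≡ proj₂ (greedyState c₁ n)
    total-greedy c₁ zero    = ≡.refl
    total-greedy c₁ (suc n) = ≡.cong (_+ greedy c₁ (suc n)) (total-greedy c₁ n)

    module Greedy {c₁} (0<c₁ : 0# < c₁) (falls : DensityFallsFarEnough I c₁ ρ) where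

      X : Sequence
      X = greedy c₁

      step : ∀ n → IsPartialRun I c₁ ρ n X → Step I ρ X n
      -- Only the sum inside `choose` is rewritten, from `total X (suc n)` to the carried sum, for
      -- which the choice is `X (suc n)` by definition.
      step n run = ≡.subst (λ S → NextSize (X n) (total X (suc n)) (choose (NextSize (X n) S)))
        (total-greedy c₁ n) (choose-satisfies _ (next-exists 0<c₁ falls n run))

      partialRun : ∀ n → IsPartialRun I c₁ ρ n X
      partialRun zero    = refl , λ i ()
      partialRun (suc n) = refl , λ i i<1+n → steps (ℕ.m<1+n⇒m<n∨m≡n i<1+n)
        where
        steps : ∀ {i} → i ℕ.< n ⊎ i ≡ n → Step I ρ X i
        steps (inj₁ i<n)    = proj₂ (partialRun n) _ i<n
        steps (inj₂ ≡.refl) = step n (partialRun n)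

      isGreedyScaling : IsGreedyScaling I c₁ ρ X
      isGreedyScaling = refl , λ n → step n (partialRun n)

    -- Competitiveness of a run.

    module Run {c₁ X} (0<c₁ : 0# < c₁) (greedy : IsGreedyScaling I c₁ ρ X) where

      inv : ∀ n → Invariant X n
      inv n = invariant 0<c₁ n (proj₁ greedy , λ i _ → proj₂ greedy i)

      module Inv n = Invariant (inv n)

      isSolution : IsSolution I X
      isSolution = Inv.positive

      -- Otherwise the totals have a supremum `s`. Each total grows by at least `X 0` in the next
      -- step, so `s - X 0` would also bound them all.
      total-unbounded : ∀ x → ∃[ n ] x ≤ total X n
      total-unbounded x with em {Lift (c ⊔ ℓ₁ ⊔ ℓ₂) (∃[ n ] x ≤ total X n)}
      ... | yes (lift ∃n) = ∃n
      ... | no bounded    = contradiction s+X0≤s (<⇒≱ (x<x+y s (isSolution 0)))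
        where
        Total : Carrier → Set (c ⊔ ℓ₁ ⊔ ℓ₂)
        Total y = Lift (c ⊔ ℓ₁ ⊔ ℓ₂) (∃[ n ] y ≈ total X n)

        sup = supremum Total (0# , lift (0 , refl)) (x , λ y (lift (n , y≈)) →
          ≤-by-contradiction λ x<y →
            bounded (lift (n , ≤-trans (proj₁ x<y) (≤-reflexive y≈))))

        s : Carrier
        s = proj₁ sup

        s+X0≤s : s + X 0 ≤ s
        s+X0≤s = begin
          s + X 0          ≤⟨ +-monoˡ-≤ (X 0) (proj₂ (proj₂ sup) (s - X 0) λ y (lift (n , y≈)) →
                                x+y≤z⇒x≤z-y (begin
                                  y + X 0          ≤⟨ +-monoʳ-≤ y (Inv.first≤ n) ⟩
                                  y + X n          ≈⟨ +-congʳ y≈ ⟩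
                                  total X (suc n)  ≤⟨ proj₁ (proj₂ sup) _ (lift (suc n , refl)) ⟩
                                  s                ∎)) ⟩
          s - X 0 + X 0    ≈⟨ //-rightDividesˡ (X 0) s ⟩
          s                ∎

      -- A downward search from a total that reaches `x`; it stops before the empty total, which is
      -- 0.
      locate : ∀ {x} → 0# < x → ∀ n → x ≤ total X n →
        ∃[ m ] total X m < x × x ≤ total X (suc m)
      locate 0<x zero x≤0 = contradiction x≤0 (<⇒≱ 0<x)
      locate {x} 0<x (suc n) x≤ with x ≤? total X n
      ... | yes x≤Sn = locate 0<x n x≤Sn
      ... | no x≰Sn  = n , ≰⇒> x≰Sn , x≤

      value-suffices : 1# ≤ ρ * d c₁ → ∀ {x} → 0# < x → ∀ n → total X n < x →
        v x ≤ ρ * value I X n x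
      value-suffices 1≤ρd {x} 0<x zero _ = begin
        x * d x                        ≤⟨ *-monoʳ-≤ 0≤x (d-≤1 x 0≤x) ⟩
        x * 1#                         ≤⟨ *-monoʳ-≤ 0≤x 1≤ρd ⟩
        x * (ρ * d c₁)                 ≈⟨ solve 3 (λ x r e → x :* (r :* e) := r :* (x :* e))
                                            refl x ρ (d c₁) ⟩
        ρ * (x * d c₁)                 ≈⟨ *-congˡ (*-cong (x-0≈x x)
                                            (d-cong (proj₁ (isSolution 0)) (proj₁ greedy))) ⟨
        ρ * ((x - 0#) * d (X 0))       ≤⟨ *-monoʳ-≤ 0≤ρ (x≤y⊔x 0# _) ⟩
        ρ * value I X 0 x              ∎
        where
        0≤x : 0# ≤ x
        0≤x = proj₁ 0<x
      -- Here `X n` is the last completed size and `X (suc n)` the growing one; the interval is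
      -- split at the threshold `p` of `X n`.
      value-suffices _ {x} 0<x (suc n) S<x with proj₂ greedy n
      ... | _ , p , thr , _ , dy≈ with ≤-total x p
      ...   | inj₁ x≤p = begin
        v x                            ≤⟨ v-nonDecreasing x p (proj₁ 0<x) x≤p ⟩
        v p                            ≤⟨ proj₁ (proj₂ thr) ⟩
        ρ * v (X n)                    ≤⟨ *-monoʳ-≤ 0≤ρ (≤-trans (x≤y⊔x (best I X n) (v (X n)))
                                            (x≤x⊔y (best I X (suc n)) _)) ⟩
        ρ * value I X (suc n) x        ∎
      ...   | inj₂ p≤x = begin
        v x                            ≤⟨ AfterSize.competitive-beyond (isSolution n)
                                            (Inv.next-total≥0 n) (Inv.total≤φ n) thr dy≈ p≤x ⟩
        ρ * ((x - total X (suc n)) * d (X (suc n)))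
                                       ≤⟨ *-monoʳ-≤ 0≤ρ (x≤y⊔x (best I X (suc n)) _) ⟩
        ρ * value I X (suc n) x        ∎

      isCompetitive : 1# ≤ ρ * d c₁ → IsCompetitive I ρ X
      isCompetitive 1≤ρd x 0<x =
        let N , x≤SN = total-unbounded x
            n , Sn<x , x≤ = locate 0<x N x≤SN
        in n , Sn<x , x≤ , value-suffices 1≤ρd 0<x n Sn<x

      -- `IsCompetitive` supplies the number of completed sizes only existentially. It is pinned
      -- down here, since any nonempty total contains a size at least `X 0`.
      first-interval : ∀ {x} → x ≤ X 0 → ∀ n → total X n < x → n ≡ 0
      first-interval x≤X0 zero    _   = ≡.refl
      first-interval {x} x≤X0 (suc n) S<x = contradiction (begin
        x                ≤⟨ x≤X0 ⟩
        X 0              ≤⟨ Inv.first≤ n ⟩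
        X n              ≤⟨ x≤x+y (X n) (Inv.total≥0 n) ⟩
        X n + total X n  ≈⟨ +-comm (X n) (total X n) ⟩
        total X (suc n)  ∎) (<⇒≱ S<x)

      -- On the first interval, competitiveness at x says that d x ≤ ρ d c₁; let x → 0.
      necessary : IsCompetitive I ρ X → 1# ≤ ρ * d c₁
      necessary competitive = ≤-by-contradiction λ ρd<1 →
        let δ , 0<δ , near = >-near d-continuous ≤-refl
              (<-≤-trans ρd<1 (≤-reflexive (sym d-0)))
            x , 0<x , x<δ , x≤X0 = small 0<δ
        in <⇒≱ (near x ( proj₁ 0<x
                       , <-≤-trans x<δ (≤-reflexive (sym (+-identityˡ δ)))
                       , <-≤-trans 0<x (x≤x+y x (proj₁ 0<δ))))
               (d≤ 0<x x≤X0)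
        where
        -- The witness is the smaller of `δ / 2#` and `X 0`.
        small : ∀ {δ} → 0# < δ → ∃[ x ] 0# < x × x < δ × x ≤ X 0
        small {δ} 0<δ with ≤-total (δ / 2#) (X 0)
        ... | inj₁ h≤X0 = δ / 2# , half-positive 0<δ , half-< 0<δ , h≤X0
        ... | inj₂ X0≤h = X 0 , isSolution 0 , ≤-<-trans X0≤h (half-< 0<δ) , ≤-refl

        d≤ : ∀ {x} → 0# < x → x ≤ X 0 → d x ≤ ρ * d c₁
        d≤ {x} 0<x x≤X0 with competitive x 0<x
        ... | n , Sn<x , _ , vx≤ with first-interval x≤X0 n Sn<x
        ...   | ≡.refl = *-cancelˡ-≤ 0<x (begin
          x * d x                             ≤⟨ vx≤ ⟩
          -- With no completed size, `best` has its default value 0, which the non-negative second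
          -- term absorbs.
          ρ * max 0# ((x - 0#) * d (X 0))     ≤⟨ *-monoʳ-≤ 0≤ρ (⊔-lub 0≤xd (≤-reflexive
                                                   (*-cong (x-0≈x x) dX0≈dc₁))) ⟩
          ρ * (x * d c₁)                      ≈⟨ solve 3 (λ x r e → r :* (x :* e) := x :* (r :* e))
                                                   refl x ρ (d c₁) ⟩
          x * (ρ * d c₁)                      ∎)
          where
          dX0≈dc₁ : d (X 0) ≈ d c₁
          dX0≈dc₁ = d-cong (proj₁ (isSolution 0)) (proj₁ greedy)

          0≤xd : 0# ≤ x * d c₁
          0≤xd = *-nonNegative (proj₁ 0<x) (proj₁ (d-positive c₁ (proj₁ 0<c₁)))

    -- From left to right, whichever competitive run is given yields the bound through its first
    -- interval; from right to left, the run built by `choose` is the witness.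
    greedyScaling-competitive⇔ : ∀ {c₁} → 0# < c₁ → DensityFallsFarEnough I c₁ ρ →
      GreedyScalingIsCompetitive I c₁ ρ ⇔ (1# / ρ ≤ d c₁)
    greedyScaling-competitive⇔ {c₁} 0<c₁ falls = mk⇔
      (λ (X , greedy , _ , competitive) → y≤x*z⇒y/z≤x 0<ρ
        (≤-trans (Run.necessary 0<c₁ greedy competitive) (≤-reflexive (*-comm ρ (d c₁)))))
      (λ 1/ρ≤d →
        let greedy = Greedy.isGreedyScaling 0<c₁ falls
            open Run 0<c₁ greedy
        in _ , greedy , isSolution , isCompetitive (begin
          1#          ≈⟨ y/z*z≈y 1# (0<x⇒x≉0 0<ρ) ⟨
          1# / ρ * ρ  ≤⟨ *-monoˡ-≤ 0≤ρ 1/ρ≤d ⟩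
          d c₁ * ρ    ≈⟨ *-comm (d c₁) ρ ⟩
          ρ * d c₁    ∎))

  -- The golden ratio in terms of the square root of 5.

  golden-nonNegative : ∀ {s} → 0# ≤ s → 0# ≤ (1# / 2#) * (1# + s)
  golden-nonNegative {s} 0≤s = *-nonNegative (proj₁ (half-positive 0<1))
    (≤-trans 0≤1 (x≤x+y 1# 0≤s))

  golden-square : ∀ {s} → s * s ≈ 5# →
    ((1# / 2#) * (1# + s)) * ((1# / 2#) * (1# + s)) ≈ (1# / 2#) * (1# + s) + 1#
  golden-square {s} s²≈5 = begin-equality
    h * (1# + s) * (h * (1# + s))
      ≈⟨ solve 2 (λ h s → h :* (con 1 :+ s) :* (h :* (con 1 :+ s)) :=
                          h :* h :* (con 1 :+ (s :+ s) :+ s :* s)) refl h s ⟩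
    h * h * (1# + (s + s) + s * s)
      ≈⟨ *-congˡ (+-congˡ s²≈5) ⟩
    h * h * (1# + (s + s) + 5#)
      -- To the solver `h` is a mere variable; the grouping isolates the two factors `h * 2#` that
      -- are replaced by 1 next.
      ≈⟨ solve 2 (λ h s → let two = con 1 :+ con 1 in
                 h :* h :* (con 1 :+ (s :+ s) :+ (two :+ two :+ con 1)) :=
                 h :* two :* (h :* (con 1 :+ s) :+ h :* two)) refl h s ⟩
    h * 2# * (h * (1# + s) + h * 2#)
      ≈⟨ *-cong h*2≈1 (+-congˡ h*2≈1) ⟩
    1# * (h * (1# + s) + 1#)
      ≈⟨ *-identityˡ _ ⟩
    h * (1# + s) + 1#
      ∎
    where
    h : Carrier
    h = 1# / 2#

    h*2≈1 : h * 2# ≈ 1#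
    h*2≈1 = y/z*z≈y 1# (0<x⇒x≉0 0<2)

theorem2 : ∀ {c ℓ₁ ℓ₂} → ExcludedMiddle (c ⊔ ℓ₁ ⊔ ℓ₂) →
    (R : CompleteOrderedField c ℓ₁ ℓ₂) →
    let open CompleteOrderedField R
        open IncMaxCont R in
    ∀ (√5 : Carrier) → 0# ≤ √5 → √5 * √5 ≈ 5# →
    let φ = (1# / 2#) * (1# + √5) in
    (I : Instance) → IsStrict I →
    let open Instance I in
    ∀ (c₁ : Carrier) → 0# < c₁ →
    DensityFallsFarEnough I c₁ (φ + 1#) →
    GreedyScalingIsCompetitive I c₁ (φ + 1#) ⇔ (1# / (φ + 1#) ≤ d c₁)
theorem2 em R √5 0≤√5 √5²≈5 I strict c₁ 0<c₁ falls =
  GreedyScaling.greedyScaling-competitive⇔ em R _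
    (golden-nonNegative em R 0≤√5) (golden-square em R √5²≈5) I strict 0<c₁ falls
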